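{- Let $(X,\mathcal{F})$ be a well-graded family with $\emptyset\in\mathcal{F}$ and additionality $r$ for some $r\in\mathbb{N}$. Let $U$ be a nonempty subset of the vertices of $G_{\mathcal{F}}$. Then $$|st(U)|+1\le|below(U)|\le|st(U)|+r.$$
   Context: A set system $(X,\mathcal{F})$ is a finite set $X$ together with a nonempty family $\mathcal{F}$ of distinct subsets of $X$. Its one-inclusion graph $G_{\mathcal{F}}$ has a vertex $v_A$ for each $A\in\mathcal{F}$, with an edge (directed from $v_A$ to $v_B$, labelled $b$) whenever $B=A\cup\{b\}$ for some $b\in X\setminus A$. The system is a well-graded family if for all $A,B\in\mathcal{F}$ the distance between $v_A$ and $v_B$ in the underlying undirected graph of $G_{\mathcal{F}}$ equals $|A\triangle B|$ (infinite distance if there is no path). $ess_{\mathcal{F}}(X)$ is the set of $x\in X$ for which there are $A,B\in\mathcal{F}$ with $x\in A$ and $x\notin B$; the additionality is $|\mathcal{F}|-|ess_{\mathcal{F}}(X)|$. For a vertex $v=v_A$ put $st(v)=A$. For a set $U$ of vertices of $G_{\mathcal{F}}$ put $st(U)=\bigcup_{v\in U}st(v)$ and $below(U)=\{v\in V(G_{\mathcal{F}}):\exists u\in U,\ st(v)\subseteq st(u)\}$. -}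

module Defs where

open import Data.Fin using (Fin)
open import Data.Fin.Properties using (any?)
open import Data.Fin.Subset using (Subset; _∈_; _∉_; _⊆_; _∪_; _─_; ⁅_⁆; ∣_∣)
open import Data.Fin.Subset.Properties using (_∈?_; _⊆?_)
open import Data.Integer using (ℤ; _⊖_)
open import Data.Nat using (ℕ; suc; _≤_; NonZero)
open import Data.Product using (∃; ∃-syntax; _×_)
open import Data.Vec using (tabulate)
open import Function.Base using (_∘_)
open import Function.Definitions using (Injective)
open import Level using (Level)
open import Relation.Binary.Construct.Closure.Symmetric using (SymClosure)
open import Relation.Binary.PropositionalEquality using (_≡_)
open import Relation.Nullary.Decidable using (does; ¬?; _×-dec_)
open import Relation.Unary using (Pred; Decidable)

-- { x | P x }
comprehension : ∀ {ℓ : Level} {n : ℕ} {P : Pred (Fin n) ℓ} → Decidable P → Subset n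
comprehension P? = tabulate (does ∘ P?)

infixr 6 _△_

_△_ : ∀ {n : ℕ} → Subset n → Subset n → Subset n
A △ B = (A ─ B) ∪ (B ─ A)

-- The ground set X is Fin n.  The family is enumerated without repetition by
-- st, so that Fin size is the vertex set of the one-inclusion graph (v is the
-- vertex v_A with A = st v) and size is the cardinality of the family.
record SetSystem (n : ℕ) : Set where
  field
    size         : ℕ
    st           : Fin size → Subset n
    st-injective : Injective _≡_ _≡_ st
    nonempty     : NonZero size

  Vertex : Set
  Vertex = Fin size

  -- The directed edge from u to v labelled b.
  Edge : Fin n → Vertex → Vertex → Set
  Edge b u v = b ∉ st u × st v ≡ st u ∪ ⁅ b ⁆

  Adjacent : Vertex → Vertex → Set
  Adjacent = SymClosure (λ u v → ∃[ b ] Edge b u v)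

  data Walk : Vertex → Vertex → ℕ → Set where
    []  : ∀ {u} → Walk u u 0
    _∷_ : ∀ {u v w k} → Adjacent u v → Walk v w k → Walk u w (suc k)

  -- "The distance between u and v is d"; no d satisfies this when u and v
  -- are not connected, i.e. at infinite distance.
  Distance : Vertex → Vertex → ℕ → Set
  Distance u v d = Walk u v d × (∀ {k} → Walk u v k → d ≤ k)

  WellGraded : Set
  WellGraded = ∀ u v → Distance u v ∣ st u △ st v ∣

  ess : Subset n
  ess = comprehension λ x →
    any? (λ u → x ∈? st u) ×-dec any? (λ v → ¬? (x ∈? st v))

  additionality : ℤ
  additionality = size ⊖ ∣ ess ∣

  -- st extended to sets of vertices: the union of st v over v ∈ U.
  St : Subset size → Subset n
  St U = comprehension λ x → any? λ v → v ∈? U ×-dec x ∈? st v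

  below : Subset size → Subset size
  below U = comprehension λ v → any? λ u → u ∈? U ×-dec st v ⊆? st u

{-# OPTIONS --safe #-}
-- Call v a generator of x when st v is inclusion-minimal among the members of the
-- family containing x.  Every member containing x contains a generator of x.
-- A walk of length |st v| from v to the vertex of ∅ must start by deleting some
-- point b from st v; if v generates x, then minimality forces b = x, so v
-- generates at most one point.  Choosing generators thus injects St U into
-- below U minus the vertex of ∅, and ess ∖ St U into the complement of below U.
module Submission where

open import Defs
open import Data.Fin using (Fin; suc)
open import Data.Fin.Properties using (any?; suc-injective; 0≢1+n)
open import Data.Fin.Subset
  using (Subset; Nonempty; inside; outside; ⊥; ∣_∣; _∈_; _∉_; _⊆_; _⊂_; _⊄_; _∪_; _∩_; _-_; ∁; ⁅_⁆)
open import Data.Fin.Subset.Induction using (⊂-wellFounded)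
open import Data.Fin.Subset.Properties
open import Data.Integer using (+_; _⊖_)
open import Data.Integer.Properties using ([1+m]⊖[1+n]≡m⊖n; +-injective)
open import Data.Nat using (ℕ; zero; suc; _+_; _∸_; _≤_; z≤n; s≤s)
open import Data.Nat.Properties
  using (module ≤-Reasoning; +-comm; +-suc; +-monoˡ-≤; +-monoʳ-≤; +-cancelʳ-≤; ≤-reflexive; ≤-trans;
         m≤n⇒m≤1+n; m+[n∸m]≡n; n≮n; +-commutativeSemigroup)
open import Algebra.Properties.CommutativeSemigroup +-commutativeSemigroup using (xy∙z≈xz∙y)
open import Data.Product using (∃-syntax; _×_; _,_; proj₁; proj₂)
open import Data.Sum using (inj₁; inj₂)
open import Data.Vec using ([]; _∷_; here; there)
open import Data.Vec.Properties using ([]=⇒lookup; lookup⇒[]=; lookup∘tabulate)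
open import Function.Base using (_∘_)
open import Induction.WellFounded using (Acc; acc)
open import Level using (Level)
open import Relation.Binary.Construct.Closure.Symmetric using (fwd; bwd)
open import Relation.Binary.PropositionalEquality using (_≡_; _≢_; refl; sym; trans; cong; subst)
open import Relation.Nullary using (yes; no; does; contradiction)
open import Relation.Nullary.Decidable using (dec-true; ¬?; _×-dec_)
open import Relation.Unary using (Pred; Decidable)

private variable
  ℓ : Level
  m n : ℕ

∈-comprehension⁺ : {P : Pred (Fin n) ℓ} (P? : Decidable P) {x : Fin n} → P x → x ∈ comprehension P?
∈-comprehension⁺ P? {x} px =
  lookup⇒[]= x _ (trans (lookup∘tabulate (does ∘ P?) x) (dec-true (P? x) px))

∈-comprehension⁻ : {P : Pred (Fin n) ℓ} (P? : Decidable P) {x : Fin n} → x ∈ comprehension P? → P x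
∈-comprehension⁻ P? {x} x∈ with P? x | trans (sym (lookup∘tabulate (does ∘ P?) x)) ([]=⇒lookup x∈)
... | yes px | _ = px

-- Pigeonhole for a relation instead of a function: generators are only known to exist, so no choice
-- function has to be built on all of `Fin m`. Induction on `p`: the partner of the first element is
-- deleted from `q`.
injective-relation⇒∣p∣≤∣q∣ :
  (R : Fin m → Fin n → Set ℓ) → (∀ {x y z} → R x z → R y z → x ≡ y) →
  (p : Subset m) (q : Subset n) → (∀ {x} → x ∈ p → ∃[ y ] y ∈ q × R x y) → ∣ p ∣ ≤ ∣ q ∣
injective-relation⇒∣p∣≤∣q∣ R inj [] q f = z≤n
injective-relation⇒∣p∣≤∣q∣ R inj (outside ∷ p) q f =
  injective-relation⇒∣p∣≤∣q∣ (R ∘ suc) (λ r s → suc-injective (inj r s)) p q (f ∘ there)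
injective-relation⇒∣p∣≤∣q∣ R inj (inside ∷ p) q f with f here
... | z , z∈q , r₀ = ≤-trans (s≤s ∣p∣≤∣q-z∣) (x∈p⇒∣p-x∣<∣p∣ z∈q)
  where
  g : ∀ {x} → x ∈ p → ∃[ y ] y ∈ q - z × R (suc x) y
  g x∈p with f (there x∈p)
  -- If `y` were the deleted `z`, it would be related to both `0` and `suc x`.
  ... | y , y∈q , r = y , x∈p∧x≢y⇒x∈p-y y∈q (λ { refl → 0≢1+n (inj r₀ r) }) , r

  ∣p∣≤∣q-z∣ : ∣ p ∣ ≤ ∣ q - z ∣
  ∣p∣≤∣q-z∣ =
    injective-relation⇒∣p∣≤∣q∣ (R ∘ suc) (λ r s → suc-injective (inj r s)) p (q - z) g

∣p∣≤∣q∣+∣p∩∁q∣ : (p q : Subset n) → ∣ p ∣ ≤ ∣ q ∣ + ∣ p ∩ ∁ q ∣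
∣p∣≤∣q∣+∣p∩∁q∣ [] [] = z≤n
∣p∣≤∣q∣+∣p∩∁q∣ (outside ∷ p) (outside ∷ q) = ∣p∣≤∣q∣+∣p∩∁q∣ p q
∣p∣≤∣q∣+∣p∩∁q∣ (outside ∷ p) (inside ∷ q) = m≤n⇒m≤1+n (∣p∣≤∣q∣+∣p∩∁q∣ p q)
∣p∣≤∣q∣+∣p∩∁q∣ (inside ∷ p) (inside ∷ q) = s≤s (∣p∣≤∣q∣+∣p∩∁q∣ p q)
∣p∣≤∣q∣+∣p∩∁q∣ (inside ∷ p) (outside ∷ q) =
  ≤-trans (s≤s (∣p∣≤∣q∣+∣p∩∁q∣ p q)) (≤-reflexive (sym (+-suc ∣ q ∣ ∣ p ∩ ∁ q ∣)))

-- The missing case `zero`, `suc b` is absurd, since the difference is then negative.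
⊖≡+⇒≡+ : ∀ a b {r} → a ⊖ b ≡ + r → a ≡ b + r
⊖≡+⇒≡+ a zero eq = +-injective eq
⊖≡+⇒≡+ (suc a) (suc b) eq = cong suc (⊖≡+⇒≡+ a b (trans (sym ([1+m]⊖[1+n]≡m⊖n a b)) eq))

∣p△⊥∣≡∣p∣ : (p : Subset n) → ∣ p △ ⊥ ∣ ≡ ∣ p ∣
∣p△⊥∣≡∣p∣ [] = refl
∣p△⊥∣≡∣p∣ (inside ∷ p) = cong suc (∣p△⊥∣≡∣p∣ p)
∣p△⊥∣≡∣p∣ (outside ∷ p) = ∣p△⊥∣≡∣p∣ p

module _ (F : SetSystem n) where
  open SetSystem F

  module _ (U : Subset size) where

    private
      ∈St? : Decidable (λ x → ∃[ u ] u ∈ U × x ∈ st u)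
      ∈St? x = any? λ u → u ∈? U ×-dec x ∈? st u

      ∈below? : Decidable (λ v → ∃[ u ] u ∈ U × st v ⊆ st u)
      ∈below? v = any? λ u → u ∈? U ×-dec st v ⊆? st u

    ∈-St⁺ : ∀ {x u} → u ∈ U → x ∈ st u → x ∈ St U
    ∈-St⁺ u∈U x∈u = ∈-comprehension⁺ ∈St? (_ , u∈U , x∈u)

    ∈-St⁻ : ∀ {x} → x ∈ St U → ∃[ u ] u ∈ U × x ∈ st u
    ∈-St⁻ = ∈-comprehension⁻ ∈St?

    ∈-below⁺ : ∀ {u v} → u ∈ U → st v ⊆ st u → v ∈ below U
    ∈-below⁺ u∈U v⊆u = ∈-comprehension⁺ ∈below? (_ , u∈U , v⊆u)

    ∈-below⁻ : ∀ {v} → v ∈ below U → ∃[ u ] u ∈ U × st v ⊆ st u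
    ∈-below⁻ = ∈-comprehension⁻ ∈below?

  ∈-ess⁻ : ∀ {x} → x ∈ ess → ∃[ u ] x ∈ st u
  ∈-ess⁻ = proj₁ ∘ ∈-comprehension⁻ λ x →
    any? (λ u → x ∈? st u) ×-dec any? (λ v → ¬? (x ∈? st v))

  Generates : Vertex → Fin n → Set
  Generates v x = x ∈ st v × (∀ w → x ∈ st w → st w ⊄ st v)

  -- Descend along strict inclusion through members containing `x`; a set at which the descent stops
  -- is minimal.
  ∃-generator : ∀ {x} u → x ∈ st u → ∃[ v ] st v ⊆ st u × Generates v x
  ∃-generator {x} u = go u (⊂-wellFounded (st u))
    where
    go : ∀ u → Acc _⊂_ (st u) → x ∈ st u → ∃[ v ] st v ⊆ st u × Generates v x
    go u (acc rs) x∈u with any? (λ w → x ∈? st w ×-dec st w ⊂? st u)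
    ... | no none = u , ⊆-refl , x∈u , λ w x∈w w⊂u → none (w , x∈w , w⊂u)
    ... | yes (w , x∈w , w⊂u) with go w (rs w⊂u) x∈w
    ...   | v , v⊆w , gen = v , ⊆-trans v⊆w (proj₁ w⊂u) , gen

  module _ (wg : WellGraded) {v₀ : Vertex} (v₀≡⊥ : st v₀ ≡ ⊥) where

    distance-v₀ : ∀ v → Distance v v₀ ∣ st v ∣
    distance-v₀ v = subst (Distance v v₀)
      (trans (cong (λ p → ∣ st v △ p ∣) v₀≡⊥) (∣p△⊥∣≡∣p∣ (st v))) (wg v v₀)

    -- A shortest walk from `v` to `v₀` has only `∣ st v ∣` steps, too few to allow a first step
    -- that adds a point.
    ∈⇒predecessor : ∀ {x} v → x ∈ st v → ∃[ w ] ∃[ b ] Edge b w v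
    ∈⇒predecessor v x∈v = first-step (proj₁ (distance-v₀ v)) refl x∈v
      where
      first-step : ∀ {x k} → Walk v v₀ k → k ≡ ∣ st v ∣ → x ∈ st v → ∃[ w ] ∃[ b ] Edge b w v
      -- The empty walk makes `v` equal to `v₀`, whose set has no points.
      first-step [] _ x∈v = contradiction (subst (_ ∈_) v₀≡⊥ x∈v) ∉⊥
      first-step (_∷_ {v = w} (bwd (b , e)) _) _ _ = w , b , e
      -- After an upward step, `k` steps remain from a set with at least `suc k` points, below its
      -- distance to `v₀`.
      first-step (_∷_ {v = w} {k = k} (fwd (b , _ , w≡v∪b)) walk) 1+k≡∣v∣ _ =
        contradiction 1+k≤k (n≮n k)
        where
        open ≤-Reasoning
        1+k≤k : suc k ≤ k
        1+k≤k = begin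
          suc k              ≡⟨ 1+k≡∣v∣ ⟩
          ∣ st v ∣           ≤⟨ ∣p∣≤∣p∪q∣ (st v) ⁅ b ⁆ ⟩
          ∣ st v ∪ ⁅ b ⁆ ∣   ≡⟨ cong ∣_∣ w≡v∪b ⟨
          ∣ st w ∣           ≤⟨ proj₂ (distance-v₀ w) walk ⟩
          k                  ∎

    -- If `x` survived the deletion of `b`, then `w` would be a strictly smaller member containing
    -- `x`.
    generates⇒≡label : ∀ {v w x b} → Generates v x → Edge b w v → x ≡ b
    generates⇒≡label {v} {w} {x} {b} (x∈v , minimal) (b∉w , v≡w∪b)
      with x∈p∪q⁻ (st w) ⁅ b ⁆ (subst (x ∈_) v≡w∪b x∈v)
    ... | inj₂ x∈b = x∈⁅y⁆⇒x≡y b x∈b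
    ... | inj₁ x∈w = contradiction w⊂v (minimal w x∈w)
      where
      w⊂v : st w ⊂ st v
      w⊂v = subst (st w ⊂_) (sym v≡w∪b)
        (p⊆p∪q ⁅ b ⁆ , b , q⊆p∪q (st w) ⁅ b ⁆ (x∈⁅x⁆ b) , b∉w)

    -- One edge into `v` serves both points: each must equal its label.
    generates-injective : ∀ {x y v} → Generates v x → Generates v y → x ≡ y
    generates-injective {v = v} gx gy with ∈⇒predecessor v (proj₁ gx)
    ... | _ , _ , e = trans (generates⇒≡label gx e) (sym (generates⇒≡label gy e))

    -- The extra 1 counts `v₀`: it lies below any element of `U`, yet generates nothing because its
    -- set is empty.
    ∣St∣+1≤∣below∣ : (U : Subset size) → Nonempty U → ∣ St U ∣ + 1 ≤ ∣ below U ∣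
    ∣St∣+1≤∣below∣ U (u₀ , u₀∈U) = begin
      (∣ St U ∣ + 1)           ≡⟨ +-comm ∣ St U ∣ 1 ⟩
      suc ∣ St U ∣             ≤⟨ s≤s ∣St∣≤∣below-v₀∣ ⟩
      suc ∣ below U - v₀ ∣     ≤⟨ x∈p⇒∣p-x∣<∣p∣ v₀∈below ⟩
      ∣ below U ∣              ∎
      where
      open ≤-Reasoning

      v₀∈below : v₀ ∈ below U
      v₀∈below = ∈-below⁺ U u₀∈U (subst (_⊆ st u₀) (sym v₀≡⊥) ⊥⊆)

      generator : ∀ {x} → x ∈ St U → ∃[ v ] v ∈ below U - v₀ × Generates v x
      generator {x} x∈St with ∈-St⁻ U x∈St
      ... | u , u∈U , x∈u with ∃-generator u x∈u
      ...   | v , v⊆u , gen = v , x∈p∧x≢y⇒x∈p-y (∈-below⁺ U u∈U v⊆u) v≢v₀ , gen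
        where
        v≢v₀ : v ≢ v₀
        v≢v₀ refl = ∉⊥ (subst (x ∈_) v₀≡⊥ (proj₁ gen))

      ∣St∣≤∣below-v₀∣ : ∣ St U ∣ ≤ ∣ below U - v₀ ∣
      ∣St∣≤∣below-v₀∣ = injective-relation⇒∣p∣≤∣q∣
        (λ x v → Generates v x) generates-injective (St U) (below U - v₀) generator

    -- Adding `∣ ∁ (below U) ∣` to both sides turns the left into `size`, that is `∣ ess ∣ + r`. It
    -- remains to inject the essential points outside `St U` into the vertices outside `below U`.
    ∣below∣≤∣St∣+r : ∀ {r} → additionality ≡ + r → (U : Subset size) → ∣ below U ∣ ≤ ∣ St U ∣ + r
    ∣below∣≤∣St∣+r {r} add U = +-cancelʳ-≤ ∣ ∁ (below U) ∣ _ _ (begin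
      (∣ below U ∣ + ∣ ∁ (below U) ∣)         ≡⟨ cong (λ k → ∣ below U ∣ + k) (∣∁p∣≡n∸∣p∣ (below U)) ⟩
      (∣ below U ∣ + (size ∸ ∣ below U ∣))    ≡⟨ m+[n∸m]≡n (∣p∣≤n (below U)) ⟩
      size                                    ≡⟨ ⊖≡+⇒≡+ size ∣ ess ∣ add ⟩
      (∣ ess ∣ + r)                           ≤⟨ +-monoˡ-≤ r (∣p∣≤∣q∣+∣p∩∁q∣ ess (St U)) ⟩
      (∣ St U ∣ + ∣ ess ∩ ∁ (St U) ∣ + r)     ≤⟨ +-monoˡ-≤ r (+-monoʳ-≤ ∣ St U ∣ ∣ess∩∁St∣≤∣∁below∣) ⟩
      (∣ St U ∣ + ∣ ∁ (below U) ∣ + r)        ≡⟨ xy∙z≈xz∙y ∣ St U ∣ ∣ ∁ (below U) ∣ r ⟩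
      (∣ St U ∣ + r + ∣ ∁ (below U) ∣)        ∎)
      where
      open ≤-Reasoning

      generator : ∀ {x} → x ∈ ess ∩ ∁ (St U) → ∃[ v ] v ∈ ∁ (below U) × Generates v x
      generator {x} x∈ with x∈p∩q⁻ ess (∁ (St U)) x∈
      ... | x∈ess , x∈∁St with ∈-ess⁻ x∈ess
      ...   | u , x∈u with ∃-generator u x∈u
      ...     | v , _ , gen = v , x∉p⇒x∈∁p v∉below , gen
        where
        v∉below : v ∉ below U
        v∉below v∈below with ∈-below⁻ U v∈below
        -- A generator of `x` inside some `st u` with `u ∈ U` would put `x` into `St U`.
        ... | u , u∈U , v⊆u = x∈∁p⇒x∉p x∈∁St (∈-St⁺ U u∈U (v⊆u (proj₁ gen)))

      ∣ess∩∁St∣≤∣∁below∣ : ∣ ess ∩ ∁ (St U) ∣ ≤ ∣ ∁ (below U) ∣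
      ∣ess∩∁St∣≤∣∁below∣ = injective-relation⇒∣p∣≤∣q∣
        (λ x v → Generates v x) generates-injective (ess ∩ ∁ (St U)) (∁ (below U)) generator

lemma3p4 : (n : ℕ) (F : SetSystem n) → let open SetSystem F in
    WellGraded →
    (∃[ v ] st v ≡ ⊥) →
    (r : ℕ) → additionality ≡ + r →
    (U : Subset size) → Nonempty U →
    (∣ St U ∣ + 1 ≤ ∣ below U ∣) × (∣ below U ∣ ≤ ∣ St U ∣ + r)
lemma3p4 n F wg (v₀ , v₀≡⊥) r add U U≢∅ =
  ∣St∣+1≤∣below∣ F wg v₀≡⊥ U U≢∅ , ∣below∣≤∣St∣+r F wg v₀≡⊥ add U
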